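{- Let $M,P_1,P_2,N$ be proof terms and $C,D$ be formulas of $\mathbf{IPC}$, and let $$M_1:=\bigl(\mathsf{case}(M,x_1.P_1,x_2.P_2,C\supset D)\bigr)N,\qquad M_2:=\mathsf{case}(M,x_1.P_1N,x_2.P_2N,D).$$ Then, in $\mathbf{F}_{\mathbf{at}}$, $$M_1^{\lozenge}=\mathrm{CASE}(M^{\lozenge},x_1.P_1^{\lozenge},x_2.P_2^{\lozenge},C^{\lozenge}\supset D^{\lozenge})@N^{\lozenge}=\mathrm{CASE}(M^{\lozenge},x_1.P_1^{\lozenge}@N^{\lozenge},x_2.P_2^{\lozenge}@N^{\lozenge},D^{\lozenge})=M_2^{\lozenge},$$ where $=$ is syntactic identity modulo $\alpha$-equivalence. In particular, whenever $M\to N$ is an instance at the root of the commuting conversion rule $\pi_\supset$ of $\mathbf{IPC}$, that is, $(\mathsf{case}(M,x.P,y.Q,C\supset D))N\to\mathsf{case}(M,x.PN,y.QN,D)$, both sides have the same image under $(\cdot)^{\lozenge}$.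
   Context: Everything is modulo $\alpha$-equivalence; bound variables are chosen distinct from the free variables of all terms/types under consideration (in particular $x_1,x_2$ are not free in $N$), and substitution is capture-avoiding. $x\notin M$, $X\notin M$, $X\notin A$ mean "not free in". **System $\mathbf{IPC}$.** Types: $A::=X\mid\perp\mid A\supset B\mid A\wedge B\mid A\vee B$ ($X$ type variables). Proof terms: $x\mid\lambda x^A.M\mid MN\mid\langle M,N\rangle\mid M1\mid M2\mid \mathsf{in}_1(M,A,B)\mid\mathsf{in}_2(N,A,B)\mid\mathsf{case}(M,x^A.P,y^B.Q,C)\mid\mathsf{abort}(M,A)$ ($M1,M2$ are the projections; $x$ is bound in $P$, $y$ in $Q$; type annotations may be omitted). **System $\mathbf{F}_{\mathbf{at}}$.** Types: $A::=X\mid A\supset B\mid A\wedge B\mid\forall X.A$. Proof terms: $x\mid\lambda x^A.M\mid MN\mid\langle M,N\rangle\mid M1\mid M2\mid\Lambda X.M\mid MX$ ($X$ a type variable). **Derived constructions in $\mathbf{F}_{\mathbf{at}}$.** - $A\,\underline\vee\,B:=\forall X.((A\supset X)\wedge(B\supset X))\supset X$ with $X\notin A,B$; $\underline\perp:=\forall X.X$. - $\underline{\lambda}x^A.M:=\lambda w^A.(\lambda x^A.M)w$ with $w\notin M$; $\langle\!\langle M,N\rangle\!\rangle:=\langle\langle M,N\rangle1,\langle M,N\rangle2\rangle$. - $M@i:=N_i$ if $M=\langle N_1,N_2\rangle$, and $M@i:=Mi$ otherwise ($i\in\{1,2\}$); $M@N:=[N/x]P$ if $M=\lambda x.P$, and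 $MN$ otherwise; $M@Y:=[Y/X]P$ if $M=\Lambda X.P$, and $MY$ otherwise. Iterated $@$ associates to the left. - $\mathrm{IN}_i(M,A,B):=\Lambda X.\lambda w^{(A\supset X)\wedge(B\supset X)}.(w\,i)M$ with $X\notin M,A,B$ and $w\notin M$. - $\mathrm{CASE}(M,x^A.P,y^B.Q,C)$ by recursion on $C$: for $C=X$ it is $(M@X)@\langle\lambda x^A.P,\lambda y^B.Q\rangle$; for $C=C_1\wedge C_2$ it is the pair with components $\mathrm{CASE}(M,x.P@i,y.Q@i,C_i)$, $i=1,2$; for $C=C_1\supset C_2$ it is $\lambda z^{C_1}.\mathrm{CASE}(M,x.P@z,y.Q@z,C_2)$ with $z\ne x,y$, $z\notin M,P,Q$; for $C=\forall X.C_0$ it is $\Lambda X.\mathrm{CASE}(M,x.P@X,y.Q@X,C_0)$ with $X\notin M,P,Q,A,B$. - $\mathrm{ABORT}(M,A)$ by recursion on $A$: $\mathrm{ABORT}(M,X)=M@X$; $\mathrm{ABORT}(M,A_1\wedge A_2)=\langle\mathrm{ABORT}(M,A_1),\mathrm{ABORT}(M,A_2)\rangle$; $\mathrm{ABORT}(M,B\supset C)=\lambda z^B.\mathrm{ABORT}(M,C)$ with $z\notin M$; $\mathrm{ABORT}(M,\forall X.A)=\Lambda X.\mathrm{ABORT}(M,A)$ with $X\notin M$. **Optimized translation $(\cdot)^\lozenge$ from $\mathbf{IPC}$ to $\mathbf{F}_{\mathbf{at}}$.** On types: $X^\lozenge=X$, $\perp^\lozenge=\underline\perp$, $(A\supset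 B)^\lozenge=A^\lozenge\supset B^\lozenge$, $(A\wedge B)^\lozenge=A^\lozenge\wedge B^\lozenge$, $(A\vee B)^\lozenge=A^\lozenge\,\underline\vee\,B^\lozenge$. On terms: $x^\lozenge=x$; $(\lambda x^A.M)^\lozenge=\underline\lambda x^{A^\lozenge}.M^\lozenge$; $\langle M,N\rangle^\lozenge=\langle\!\langle M^\lozenge,N^\lozenge\rangle\!\rangle$; $(\mathsf{in}_i(M,A,B))^\lozenge=\mathrm{IN}_i(M^\lozenge,A^\lozenge,B^\lozenge)$; $(MN)^\lozenge=M^\lozenge@N^\lozenge$; $(Mi)^\lozenge=M^\lozenge@i$; $\mathsf{case}(M,x^A.P,y^B.Q,C)^\lozenge=\mathrm{CASE}(M^\lozenge,x^{A^\lozenge}.P^\lozenge,y^{B^\lozenge}.Q^\lozenge,C^\lozenge)$; $\mathsf{abort}(M,A)^\lozenge=\mathrm{ABORT}(M^\lozenge,A^\lozenge)$. -}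

module Defs where

open import Data.Fin.Base using (Fin; zero; suc)
open import Data.Nat.Base using (ℕ; suc)

-- α-equivalence is handled by well-scoped de Bruijn indices: n counts the type
-- variables in scope, m the term variables.  Syntactic identity modulo
-- α-equivalence is then _≡_, and "z ∉ M" becomes a weakening of M.  Terms are
-- raw: no typing is assumed.

private
  variable
    n n′ m m′ : ℕ

data Ix : Set where
  𝟏 𝟐 : Ix

ext : (Fin m → Fin m′) → Fin (suc m) → Fin (suc m′)
ext ρ zero    = zero
ext ρ (suc i) = suc (ρ i)

module IPC where

  infixr 6 _⊃_
  infixr 7 _∨_
  infixr 8 _∧_

  data Ty (n : ℕ) : Set where
    tvar        : Fin n → Ty n
    bot         : Ty n
    _⊃_ _∧_ _∨_ : Ty n → Ty n → Ty n

  data Tm (n m : ℕ) : Set where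
    var   : Fin m → Tm n m
    lam   : Ty n → Tm n (suc m) → Tm n m
    app   : Tm n m → Tm n m → Tm n m
    pair  : Tm n m → Tm n m → Tm n m
    proj  : Tm n m → Ix → Tm n m
    inj   : Ix → Tm n m → Ty n → Ty n → Tm n m
    case  : Tm n m → Ty n → Tm n (suc m) → Ty n → Tm n (suc m) → Ty n → Tm n m
    abort : Tm n m → Ty n → Tm n m

  ren : (Fin m → Fin m′) → Tm n m → Tm n m′
  ren ρ (var x)            = var (ρ x)
  ren ρ (lam A M)          = lam A (ren (ext ρ) M)
  ren ρ (app M N)          = app (ren ρ M) (ren ρ N)
  ren ρ (pair M N)         = pair (ren ρ M) (ren ρ N)
  ren ρ (proj M i)         = proj (ren ρ M) i
  ren ρ (inj i M A B)      = inj i (ren ρ M) A B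
  ren ρ (case M A P B Q C) = case (ren ρ M) A (ren (ext ρ) P) B (ren (ext ρ) Q) C
  ren ρ (abort M A)        = abort (ren ρ M) A

  wk : Tm n m → Tm n (suc m)
  wk = ren suc

  infix 4 _⟶π⊃_

  -- Root instances only; there is no congruence closure.
  data _⟶π⊃_ {n m : ℕ} : Tm n m → Tm n m → Set where
    π⊃ : ∀ (M : Tm n m) (A : Ty n) (P : Tm n (suc m)) (B : Ty n) (Q : Tm n (suc m))
           (C D : Ty n) (N : Tm n m) →
         app (case M A P B Q (C ⊃ D)) N
           ⟶π⊃ case M A (app P (wk N)) B (app Q (wk N)) D

module Fat where

  infixr 6 _⊃_
  infixr 8 _∧_
  infixr 7 _⊻_
  infixl 9 _⊚_ _⊚ᵢ_ _⊚ₜ_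

  data Ty (n : ℕ) : Set where
    tvar    : Fin n → Ty n
    _⊃_ _∧_ : Ty n → Ty n → Ty n
    all     : Ty (suc n) → Ty n

  data Tm (n m : ℕ) : Set where
    var  : Fin m → Tm n m
    lam  : Ty n → Tm n (suc m) → Tm n m
    app  : Tm n m → Tm n m → Tm n m
    pair : Tm n m → Tm n m → Tm n m
    proj : Tm n m → Ix → Tm n m
    Lam  : Tm (suc n) m → Tm n m
    tapp : Tm n m → Fin n → Tm n m

  renTy : (Fin n → Fin n′) → Ty n → Ty n′
  renTy ρ (tvar X) = tvar (ρ X)
  renTy ρ (A ⊃ B)  = renTy ρ A ⊃ renTy ρ B
  renTy ρ (A ∧ B)  = renTy ρ A ∧ renTy ρ B
  renTy ρ (all A)  = all (renTy (ext ρ) A)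

  wkTy : Ty n → Ty (suc n)
  wkTy = renTy suc

  tren : (Fin n → Fin n′) → Tm n m → Tm n′ m
  tren ρ (var x)    = var x
  tren ρ (lam A M)  = lam (renTy ρ A) (tren ρ M)
  tren ρ (app M N)  = app (tren ρ M) (tren ρ N)
  tren ρ (pair M N) = pair (tren ρ M) (tren ρ N)
  tren ρ (proj M i) = proj (tren ρ M) i
  tren ρ (Lam M)    = Lam (tren (ext ρ) M)
  tren ρ (tapp M X) = tapp (tren ρ M) (ρ X)

  twk : Tm n m → Tm (suc n) m
  twk = tren suc

  ren : (Fin m → Fin m′) → Tm n m → Tm n m′
  ren ρ (var x)    = var (ρ x)
  ren ρ (lam A M)  = lam A (ren (ext ρ) M)
  ren ρ (app M N)  = app (ren ρ M) (ren ρ N)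
  ren ρ (pair M N) = pair (ren ρ M) (ren ρ N)
  ren ρ (proj M i) = proj (ren ρ M) i
  ren ρ (Lam M)    = Lam (ren ρ M)
  ren ρ (tapp M X) = tapp (ren ρ M) X

  wk : Tm n m → Tm n (suc m)
  wk = ren suc

  exts : (Fin m → Tm n m′) → Fin (suc m) → Tm n (suc m′)
  exts σ zero    = var zero
  exts σ (suc x) = wk (σ x)

  sub : (Fin m → Tm n m′) → Tm n m → Tm n m′
  sub σ (var x)    = σ x
  sub σ (lam A M)  = lam A (sub (exts σ) M)
  sub σ (app M N)  = app (sub σ M) (sub σ N)
  sub σ (pair M N) = pair (sub σ M) (sub σ N)
  sub σ (proj M i) = proj (sub σ M) i
  sub σ (Lam M)    = Lam (sub (λ x → twk (σ x)) M)
  sub σ (tapp M X) = tapp (sub σ M) X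

  inst : Tm n m → Fin (suc m) → Tm n m
  inst N zero    = N
  inst N (suc x) = var x

  _[_] : Tm n (suc m) → Tm n m → Tm n m
  P [ N ] = sub (inst N) P

  tinst : Fin n → Fin (suc n) → Fin n
  tinst Y zero    = Y
  tinst Y (suc X) = X

  -- Only type variables are ever substituted for type variables, so [Y/X]P is
  -- a renaming.
  _[_]ₜ : Tm (suc n) m → Fin n → Tm n m
  P [ Y ]ₜ = tren (tinst Y) P

  _⊻_ : Ty n → Ty n → Ty n
  A ⊻ B = all (((wkTy A ⊃ tvar zero) ∧ (wkTy B ⊃ tvar zero)) ⊃ tvar zero)

  ⊥̲ : Ty n
  ⊥̲ = all (tvar zero)

  lam̲ : Ty n → Tm n (suc m) → Tm n m
  lam̲ A M = lam A (app (wk (lam A M)) (var zero))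

  ⟪_,_⟫ : Tm n m → Tm n m → Tm n m
  ⟪ M , N ⟫ = pair (proj (pair M N) 𝟏) (proj (pair M N) 𝟐)

  -- M@i, M@N and M@Y: redexes are contracted on the spot, and only at the root.
  _⊚ᵢ_ : Tm n m → Ix → Tm n m
  pair M N ⊚ᵢ 𝟏 = M
  pair M N ⊚ᵢ 𝟐 = N
  M        ⊚ᵢ i = proj M i

  _⊚_ : Tm n m → Tm n m → Tm n m
  lam A P ⊚ N = P [ N ]
  M       ⊚ N = app M N

  _⊚ₜ_ : Tm n m → Fin n → Tm n m
  Lam P ⊚ₜ Y = P [ Y ]ₜ
  M     ⊚ₜ Y = tapp M Y

  IN : Ix → Tm n m → Ty n → Ty n → Tm n m
  IN i M A B =
    Lam (lam ((wkTy A ⊃ tvar zero) ∧ (wkTy B ⊃ tvar zero))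
             (app (proj (var zero) i) (wk (twk M))))

  -- In the implication clause the fresh z is bound outside x and y, so inside
  -- the branches x (or y) is index 0 and z is index 1.
  CASE : Tm n m → Ty n → Tm n (suc m) → Ty n → Tm n (suc m) → Ty n → Tm n m
  CASE M A P B Q (tvar X)  = M ⊚ₜ X ⊚ pair (lam A P) (lam B Q)
  CASE M A P B Q (C₁ ∧ C₂) =
    pair (CASE M A (P ⊚ᵢ 𝟏) B (Q ⊚ᵢ 𝟏) C₁)
         (CASE M A (P ⊚ᵢ 𝟐) B (Q ⊚ᵢ 𝟐) C₂)
  CASE M A P B Q (C₁ ⊃ C₂) =
    lam C₁ (CASE (wk M)
                 A (ren (ext suc) P ⊚ var (suc zero))
                 B (ren (ext suc) Q ⊚ var (suc zero))
                 C₂)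
  CASE M A P B Q (all C₀)  =
    Lam (CASE (twk M) (wkTy A) (twk P ⊚ₜ zero) (wkTy B) (twk Q ⊚ₜ zero) C₀)

  ABORT : Tm n m → Ty n → Tm n m
  ABORT M (tvar X)  = M ⊚ₜ X
  ABORT M (A₁ ∧ A₂) = pair (ABORT M A₁) (ABORT M A₂)
  ABORT M (B ⊃ C)   = lam B (ABORT (wk M) C)
  ABORT M (all A)   = Lam (ABORT (twk M) A)

infix 10 _◇ₜ _◇

_◇ₜ : IPC.Ty n → Fat.Ty n
IPC.tvar X    ◇ₜ = Fat.tvar X
IPC.bot       ◇ₜ = Fat.⊥̲
(A IPC.⊃ B)   ◇ₜ = (A ◇ₜ) Fat.⊃ (B ◇ₜ)
(A IPC.∧ B)   ◇ₜ = (A ◇ₜ) Fat.∧ (B ◇ₜ)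
(A IPC.∨ B)   ◇ₜ = (A ◇ₜ) Fat.⊻ (B ◇ₜ)

_◇ : IPC.Tm n m → Fat.Tm n m
IPC.var x            ◇ = Fat.var x
IPC.lam A M          ◇ = Fat.lam̲ (A ◇ₜ) (M ◇)
IPC.app M N          ◇ = (M ◇) Fat.⊚ (N ◇)
IPC.pair M N         ◇ = Fat.⟪ M ◇ , N ◇ ⟫
IPC.proj M i         ◇ = (M ◇) Fat.⊚ᵢ i
IPC.inj i M A B      ◇ = Fat.IN i (M ◇) (A ◇ₜ) (B ◇ₜ)
IPC.case M A P B Q C ◇ = Fat.CASE (M ◇) (A ◇ₜ) (P ◇) (B ◇ₜ) (Q ◇) (C ◇ₜ)
IPC.abort M A        ◇ = Fat.ABORT (M ◇) (A ◇ₜ)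

{-# OPTIONS --safe #-}
module Submission where

-- Unfolding CASE at C ⊃ D gives a λ whose body is CASE at D with branches P₁@z
-- and P₂@z, so the theorem says that [N/z] commutes with this CASE.  In general
-- it does not, because substitution does not commute with @: if P = λw.w then
-- [N/z](P@z@z′) = N z′, whereas P@N@z′ contracts when N is a λ.  The failure
-- occurs only when peeling introductions off a branch exposes a variable bound
-- by one of them.  The translation never produces such terms, thanks to the
-- η-redexes and projection redexes built into lam̲ and ⟪_,_⟫, and this
-- invariant is preserved by @.

open import Data.Nat.Base using (ℕ; suc)
open import Data.Product using (_×_; _,_; ∃)
open import Data.Empty using (⊥)
open import Data.Unit using (⊤; tt)
open import Data.Fin.Base using (Fin; zero; suc)
open import Data.Vec.Functional using (_∷_)
open import Level using (0ℓ)
open import Relation.Unary using (Pred)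
open import Relation.Binary.PropositionalEquality
  using (_≡_; refl; sym; trans; cong; cong₂)
open import Defs
open Fat

private
  variable
    n n′ n″ m m′ m″ : ℕ

-- Renaming and substitution calculus

-- Composites are compared with a third map only pointwise, here and below: `ext ρ′ ∘ ext ρ` and
-- `ext (ρ′ ∘ ρ)` agree at each index but are not definitionally equal functions, so the pointwise
-- hypothesis is what passes under binders.
ext-∘ : {ρ : Fin m → Fin m′} {ρ′ : Fin m′ → Fin m″} {ρ″ : Fin m → Fin m″} →
        (∀ x → ρ′ (ρ x) ≡ ρ″ x) → ∀ x → ext ρ′ (ext ρ x) ≡ ext ρ″ x
ext-∘ h zero    = refl
ext-∘ h (suc x) = cong suc (h x)

renTy-renTy : {ρ : Fin n → Fin n′} {ρ′ : Fin n′ → Fin n″} {ρ″ : Fin n → Fin n″} →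
              (∀ X → ρ′ (ρ X) ≡ ρ″ X) → ∀ A → renTy ρ′ (renTy ρ A) ≡ renTy ρ″ A
renTy-renTy h (tvar X) = cong tvar (h X)
renTy-renTy h (A ⊃ B)  = cong₂ _⊃_ (renTy-renTy h A) (renTy-renTy h B)
renTy-renTy h (A ∧ B)  = cong₂ _∧_ (renTy-renTy h A) (renTy-renTy h B)
renTy-renTy h (all A)  = cong all (renTy-renTy (ext-∘ h) A)

tren-tren : {ρ : Fin n → Fin n′} {ρ′ : Fin n′ → Fin n″} {ρ″ : Fin n → Fin n″} →
            (∀ X → ρ′ (ρ X) ≡ ρ″ X) → (M : Tm n m) → tren ρ′ (tren ρ M) ≡ tren ρ″ M
tren-tren h (var x)    = refl
tren-tren h (lam A M)  = cong₂ lam (renTy-renTy h A) (tren-tren h M)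
tren-tren h (app M N)  = cong₂ app (tren-tren h M) (tren-tren h N)
tren-tren h (pair M N) = cong₂ pair (tren-tren h M) (tren-tren h N)
tren-tren h (proj M i) = cong (λ T → proj T i) (tren-tren h M)
tren-tren h (Lam M)    = cong Lam (tren-tren (ext-∘ h) M)
tren-tren h (tapp M X) = cong₂ tapp (tren-tren h M) (h X)

renTy-id : {ρ : Fin n → Fin n} → (∀ X → ρ X ≡ X) → ∀ A → renTy ρ A ≡ A
renTy-id h (tvar X) = cong tvar (h X)
renTy-id h (A ⊃ B)  = cong₂ _⊃_ (renTy-id h A) (renTy-id h B)
renTy-id h (A ∧ B)  = cong₂ _∧_ (renTy-id h A) (renTy-id h B)
renTy-id h (all A)  = cong all (renTy-id (λ { zero → refl ; (suc X) → cong suc (h X) }) A)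

tren-id : {ρ : Fin n → Fin n} → (∀ X → ρ X ≡ X) → (M : Tm n m) → tren ρ M ≡ M
tren-id h (var x)    = refl
tren-id h (lam A M)  = cong₂ lam (renTy-id h A) (tren-id h M)
tren-id h (app M N)  = cong₂ app (tren-id h M) (tren-id h N)
tren-id h (pair M N) = cong₂ pair (tren-id h M) (tren-id h N)
tren-id h (proj M i) = cong (λ T → proj T i) (tren-id h M)
tren-id h (Lam M)    = cong Lam (tren-id (λ { zero → refl ; (suc X) → cong suc (h X) }) M)
tren-id h (tapp M X) = cong₂ tapp (tren-id h M) (h X)

ren-ren : {ρ : Fin m → Fin m′} {ρ′ : Fin m′ → Fin m″} {ρ″ : Fin m → Fin m″} →
          (∀ x → ρ′ (ρ x) ≡ ρ″ x) → (M : Tm n m) → ren ρ′ (ren ρ M) ≡ ren ρ″ M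
ren-ren h (var x)    = cong var (h x)
ren-ren h (lam A M)  = cong (lam A) (ren-ren (ext-∘ h) M)
ren-ren h (app M N)  = cong₂ app (ren-ren h M) (ren-ren h N)
ren-ren h (pair M N) = cong₂ pair (ren-ren h M) (ren-ren h N)
ren-ren h (proj M i) = cong (λ T → proj T i) (ren-ren h M)
ren-ren h (Lam M)    = cong Lam (ren-ren h M)
ren-ren h (tapp M X) = cong (λ T → tapp T X) (ren-ren h M)

tren-ren : (θ : Fin n → Fin n′) (ρ : Fin m → Fin m′) (M : Tm n m) →
           tren θ (ren ρ M) ≡ ren ρ (tren θ M)
tren-ren θ ρ (var x)    = refl
tren-ren θ ρ (lam A M)  = cong (lam _) (tren-ren θ (ext ρ) M)
tren-ren θ ρ (app M N)  = cong₂ app (tren-ren θ ρ M) (tren-ren θ ρ N)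
tren-ren θ ρ (pair M N) = cong₂ pair (tren-ren θ ρ M) (tren-ren θ ρ N)
tren-ren θ ρ (proj M i) = cong (λ T → proj T i) (tren-ren θ ρ M)
tren-ren θ ρ (Lam M)    = cong Lam (tren-ren (ext θ) ρ M)
tren-ren θ ρ (tapp M X) = cong (λ T → tapp T _) (tren-ren θ ρ M)

sub-ren : {ρ : Fin m → Fin m′} {σ : Fin m′ → Tm n m″} {τ : Fin m → Tm n m″} →
          (∀ x → σ (ρ x) ≡ τ x) → ∀ M → sub σ (ren ρ M) ≡ sub τ M
sub-ren h (var x)    = h x
sub-ren h (lam A M)  =
  cong (lam A) (sub-ren (λ { zero → refl ; (suc x) → cong wk (h x) }) M)
sub-ren h (app M N)  = cong₂ app (sub-ren h M) (sub-ren h N)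
sub-ren h (pair M N) = cong₂ pair (sub-ren h M) (sub-ren h N)
sub-ren h (proj M i) = cong (λ T → proj T i) (sub-ren h M)
sub-ren h (Lam M)    = cong Lam (sub-ren (λ x → cong twk (h x)) M)
sub-ren h (tapp M X) = cong (λ T → tapp T X) (sub-ren h M)

ren-wk : (ρ : Fin m → Fin m′) (M : Tm n m) → ren (ext ρ) (wk M) ≡ wk (ren ρ M)
ren-wk ρ M = trans (ren-ren (λ _ → refl) M) (sym (ren-ren (λ _ → refl) M))

ren-sub : {σ : Fin m → Tm n m′} {ρ : Fin m′ → Fin m″} {τ : Fin m → Tm n m″} →
          (∀ x → ren ρ (σ x) ≡ τ x) → ∀ M → ren ρ (sub σ M) ≡ sub τ M
ren-sub h (var x)    = h x
ren-sub {σ = σ} {ρ} h (lam A M) =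
  cong (lam A) (ren-sub (λ { zero    → refl
                           ; (suc x) → trans (ren-wk ρ (σ x)) (cong wk (h x)) }) M)
ren-sub h (app M N)  = cong₂ app (ren-sub h M) (ren-sub h N)
ren-sub h (pair M N) = cong₂ pair (ren-sub h M) (ren-sub h N)
ren-sub h (proj M i) = cong (λ T → proj T i) (ren-sub h M)
ren-sub {σ = σ} {ρ} h (Lam M) =
  cong Lam (ren-sub (λ x → trans (sym (tren-ren suc ρ (σ x))) (cong twk (h x))) M)
ren-sub h (tapp M X) = cong (λ T → tapp T X) (ren-sub h M)

tren-exts : {θ : Fin n → Fin n′} {σ : Fin m → Tm n m′} {τ : Fin m → Tm n′ m′} →
            (∀ x → tren θ (σ x) ≡ τ x) → ∀ x → tren θ (exts σ x) ≡ exts τ x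
tren-exts h zero = refl
tren-exts {θ = θ} {σ} h (suc x) = trans (tren-ren θ suc (σ x)) (cong wk (h x))

tren-sub : {θ : Fin n → Fin n′} {σ : Fin m → Tm n m′} {τ : Fin m → Tm n′ m′} →
           (∀ x → tren θ (σ x) ≡ τ x) → ∀ M → tren θ (sub σ M) ≡ sub τ (tren θ M)
tren-sub h (var x)    = h x
tren-sub h (lam A M)  = cong (lam _) (tren-sub (tren-exts h) M)
tren-sub h (app M N)  = cong₂ app (tren-sub h M) (tren-sub h N)
tren-sub h (pair M N) = cong₂ pair (tren-sub h M) (tren-sub h N)
tren-sub h (proj M i) = cong (λ T → proj T i) (tren-sub h M)
tren-sub {σ = σ} h (Lam M) = cong Lam (tren-sub (λ x →
  trans (tren-tren (λ _ → refl) (σ x))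
        (trans (sym (tren-tren (λ _ → refl) (σ x))) (cong twk (h x)))) M)
tren-sub h (tapp M X) = cong (λ T → tapp T _) (tren-sub h M)

sub-wk : (σ : Fin m → Tm n m′) (M : Tm n m) → sub (exts σ) (wk M) ≡ wk (sub σ M)
sub-wk σ M = trans (sub-ren (λ _ → refl) M) (sym (ren-sub (λ _ → refl) M))

sub-twk : (σ : Fin m → Tm n m′) (M : Tm n m) →
          sub (λ x → twk (σ x)) (twk M) ≡ twk (sub σ M)
sub-twk σ M = sym (tren-sub (λ _ → refl) M)

sub-sub : {σ : Fin m → Tm n m′} {τ : Fin m′ → Tm n m″} {υ : Fin m → Tm n m″} →
          (∀ x → sub τ (σ x) ≡ υ x) → ∀ M → sub τ (sub σ M) ≡ sub υ M
sub-sub h (var x)    = h x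
sub-sub {σ = σ} {τ} h (lam A M) =
  cong (lam A) (sub-sub (λ { zero    → refl
                           ; (suc x) → trans (sub-wk τ (σ x)) (cong wk (h x)) }) M)
sub-sub h (app M N)  = cong₂ app (sub-sub h M) (sub-sub h N)
sub-sub h (pair M N) = cong₂ pair (sub-sub h M) (sub-sub h N)
sub-sub h (proj M i) = cong (λ T → proj T i) (sub-sub h M)
sub-sub {σ = σ} {τ} h (Lam M) =
  cong Lam (sub-sub (λ x → trans (sub-twk τ (σ x)) (cong twk (h x))) M)
sub-sub h (tapp M X) = cong (λ T → tapp T X) (sub-sub h M)

sub-id : {σ : Fin m → Tm n m} → (∀ x → σ x ≡ var x) → ∀ M → sub σ M ≡ M
sub-id h (var x)    = h x
sub-id h (lam A M)  =
  cong (lam A) (sub-id (λ { zero → refl ; (suc x) → cong wk (h x) }) M)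
sub-id h (app M N)  = cong₂ app (sub-id h M) (sub-id h N)
sub-id h (pair M N) = cong₂ pair (sub-id h M) (sub-id h N)
sub-id h (proj M i) = cong (λ T → proj T i) (sub-id h M)
sub-id h (Lam M)    = cong Lam (sub-id (λ x → cong twk (h x)) M)
sub-id h (tapp M X) = cong (λ T → tapp T X) (sub-id h M)

sub-ren-id : {ρ : Fin m → Fin m′} {σ : Fin m′ → Tm n m} →
             (∀ x → σ (ρ x) ≡ var x) → ∀ M → sub σ (ren ρ M) ≡ M
sub-ren-id h M = trans (sub-ren h M) (sub-id (λ _ → refl) M)

sub-var-ren : (ρ : Fin m → Fin m′) (M : Tm n m) → sub (λ x → var (ρ x)) M ≡ ren ρ M
sub-var-ren ρ M = trans (sym (sub-ren (λ _ → refl) M)) (sub-id (λ _ → refl) (ren ρ M))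

-- Both sides are `P` under the single substitution that sends index 0 to `sub σ N` and `suc x` to
-- `σ x`.
sub-[] : (σ : Fin m → Tm n m′) (P : Tm n (suc m)) (N : Tm n m) →
         sub σ (P [ N ]) ≡ sub (exts σ) P [ sub σ N ]
sub-[] σ P N = trans (sub-sub (λ _ → refl) P) (sym (sub-sub
  (λ { zero → refl ; (suc x) → sub-ren-id (λ _ → refl) (σ x) }) P))

sub-[]ₜ : (σ : Fin m → Tm n m′) (P : Tm (suc n) m) (Y : Fin n) →
          sub σ (P [ Y ]ₜ) ≡ sub (λ x → twk (σ x)) P [ Y ]ₜ
sub-[]ₜ σ P Y = sym (tren-sub (λ x →
  trans (tren-tren (λ _ → refl) (σ x)) (tren-id (λ _ → refl) (σ x))) P)

-- The invariant on exposed variables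

-- Exposed V M: peeling introductions off M reaches either an elimination or a
-- variable in V; the ⊥ excludes the variables bound by the peeled λs.
data Exposed {n m : ℕ} (V : Pred (Fin m) 0ℓ) : Tm n m → Set where
  var  : ∀ {x} → V x → Exposed V (var x)
  lam  : ∀ {A M} → Exposed (⊥ ∷ V) M → Exposed V (lam A M)
  app  : ∀ {M N} → Exposed V (app M N)
  pair : ∀ {M N} → Exposed V M → Exposed V N → Exposed V (pair M N)
  proj : ∀ {M i} → Exposed V (proj M i)
  Lam  : ∀ {M} → Exposed V M → Exposed V (Lam M)
  tapp : ∀ {M X} → Exposed V (tapp M X)

ext-∈ : {S : Set} {V : Pred (Fin m) 0ℓ} {W : Pred (Fin m′) 0ℓ} {ρ : Fin m → Fin m′} →
        (∀ x → V x → W (ρ x)) → ∀ x → (S ∷ V) x → (S ∷ W) (ext ρ x)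
ext-∈ h zero    s = s
ext-∈ h (suc x) v = h x v

Exposed-ren : {V : Pred (Fin m) 0ℓ} {W : Pred (Fin m′) 0ℓ} {ρ : Fin m → Fin m′} →
              (∀ x → V x → W (ρ x)) → {M : Tm n m} → Exposed V M → Exposed W (ren ρ M)
Exposed-ren h (var v)    = var (h _ v)
Exposed-ren {V = V} {W} h (lam e) = lam (Exposed-ren (ext-∈ {V = V} {W} h) e)
Exposed-ren h app        = app
Exposed-ren h (pair e f) = pair (Exposed-ren h e) (Exposed-ren h f)
Exposed-ren h proj       = proj
Exposed-ren h (Lam e)    = Lam (Exposed-ren h e)
Exposed-ren h tapp       = tapp

Exposed-wk : {S : Set} {V : Pred (Fin m) 0ℓ} {M : Tm n m} →
             Exposed V M → Exposed (S ∷ V) (wk M)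
Exposed-wk = Exposed-ren (λ _ v → v)

Exposed-tren : {V : Pred (Fin m) 0ℓ} {θ : Fin n → Fin n′} {M : Tm n m} →
               Exposed V M → Exposed V (tren θ M)
Exposed-tren (var v)    = var v
Exposed-tren (lam e)    = lam (Exposed-tren e)
Exposed-tren app        = app
Exposed-tren (pair e f) = pair (Exposed-tren e) (Exposed-tren f)
Exposed-tren proj       = proj
Exposed-tren (Lam e)    = Lam (Exposed-tren e)
Exposed-tren tapp       = tapp

-- Only the images of exposed variables matter, because an elimination stays an elimination under
-- any `σ`. Under a λ the new index lies in `⊥`, so its case is vacuous.
Exposed-sub : {V : Pred (Fin m) 0ℓ} {W : Pred (Fin m′) 0ℓ} {σ : Fin m → Tm n m′} →
              (∀ x → V x → Exposed W (σ x)) → {M : Tm n m} →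
              Exposed V M → Exposed W (sub σ M)
Exposed-sub h (var v)    = h _ v
Exposed-sub h (lam e)    =
  lam (Exposed-sub (λ { zero () ; (suc x) v → Exposed-wk (h x v) }) e)
Exposed-sub h app        = app
Exposed-sub h (pair e f) = pair (Exposed-sub h e) (Exposed-sub h f)
Exposed-sub h proj       = proj
Exposed-sub h (Lam e)    = Lam (Exposed-sub (λ x v → Exposed-tren (h x v)) e)
Exposed-sub h tapp       = tapp

module _ {V : Pred (Fin m) 0ℓ} where

  Exposed-⊚ᵢ : {M : Tm n m} (i : Ix) → Exposed V M → Exposed V (M ⊚ᵢ i)
  Exposed-⊚ᵢ i (var v)    = proj
  Exposed-⊚ᵢ i (lam e)    = proj
  Exposed-⊚ᵢ i app        = proj
  Exposed-⊚ᵢ 𝟏 (pair e f) = e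
  Exposed-⊚ᵢ 𝟐 (pair e f) = f
  Exposed-⊚ᵢ i proj       = proj
  Exposed-⊚ᵢ i (Lam e)    = proj
  Exposed-⊚ᵢ i tapp       = proj

  -- When `M` is a λ, contraction puts `N` in place of a variable that is never exposed in the body,
  -- so `N` never surfaces and the exposed leaves remain those of `M`.
  Exposed-⊚ : {M N : Tm n m} → Exposed V M → Exposed V (M ⊚ N)
  Exposed-⊚ (var v)    = app
  Exposed-⊚ (lam e)    = Exposed-sub (λ { zero () ; (suc x) v → var v }) e
  Exposed-⊚ app        = app
  Exposed-⊚ (pair e f) = app
  Exposed-⊚ proj       = app
  Exposed-⊚ (Lam e)    = app
  Exposed-⊚ tapp       = app

  Exposed-⊚ₜ : {M : Tm n m} {Y : Fin n} → Exposed V M → Exposed V (M ⊚ₜ Y)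
  Exposed-⊚ₜ (var v)    = tapp
  Exposed-⊚ₜ (lam e)    = tapp
  Exposed-⊚ₜ app        = tapp
  Exposed-⊚ₜ (pair e f) = tapp
  Exposed-⊚ₜ proj       = tapp
  Exposed-⊚ₜ (Lam e)    = Exposed-tren e
  Exposed-⊚ₜ tapp       = tapp

-- At an atomic type the branches occur only inside the argument of `⊚`, which cannot surface; the
-- other types add introductions around this, and the variable bound at `C₁ ⊃ C₂` is fresh for `M`.
Exposed-CASE : {V : Pred (Fin m) 0ℓ} {M : Tm n m} {A B : Ty n} {P Q : Tm n (suc m)}
               (C : Ty n) → Exposed V M → Exposed V (CASE M A P B Q C)
Exposed-CASE (tvar X)  e = Exposed-⊚ (Exposed-⊚ₜ e)
Exposed-CASE (C₁ ∧ C₂) e = pair (Exposed-CASE C₁ e) (Exposed-CASE C₂ e)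
Exposed-CASE (C₁ ⊃ C₂) e = lam (Exposed-CASE C₂ (Exposed-wk e))
Exposed-CASE (all C)   e = Lam (Exposed-CASE C (Exposed-tren e))

Exposed-ABORT : {V : Pred (Fin m) 0ℓ} {M : Tm n m} (A : Ty n) →
                Exposed V M → Exposed V (ABORT M A)
Exposed-ABORT (tvar X)  e = Exposed-⊚ₜ e
Exposed-ABORT (A₁ ∧ A₂) e = pair (Exposed-ABORT A₁ e) (Exposed-ABORT A₂ e)
Exposed-ABORT (A₁ ⊃ A₂) e = lam (Exposed-ABORT A₂ (Exposed-wk e))
Exposed-ABORT (all A)   e = Lam (Exposed-ABORT A (Exposed-tren e))

-- Abstraction, pairing and injection need no induction: directly beneath the introductions they
-- create stands an application or a projection. The remaining compound cases follow the principal
-- subterm.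
◇-Exposed : {V : Pred (Fin m) 0ℓ} → (∀ x → V x) → (M : IPC.Tm n m) → Exposed V (M ◇)
◇-Exposed v (IPC.var x)            = var (v x)
◇-Exposed v (IPC.lam A M)          = lam app
◇-Exposed v (IPC.app M N)          = Exposed-⊚ (◇-Exposed v M)
◇-Exposed v (IPC.pair M N)         = pair proj proj
◇-Exposed v (IPC.proj M i)         = Exposed-⊚ᵢ i (◇-Exposed v M)
◇-Exposed v (IPC.inj i M A B)      = Lam (lam app)
◇-Exposed v (IPC.case M A P B Q C) = Exposed-CASE (C ◇ₜ) (◇-Exposed v M)
◇-Exposed v (IPC.abort M A)        = Exposed-ABORT (A ◇ₜ) (◇-Exposed v M)

-- Substitution commutes with @, CASE and ABORT

-- Outside `V` the substitution is arbitrary; this leaves room for `inst N`, which puts a possible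
-- introduction at index 0.
RenamesOn : Pred (Fin m) 0ℓ → (Fin m → Tm n m′) → Set
RenamesOn V σ = ∀ x → V x → ∃ λ y → σ x ≡ var y

-- The new variable is sent to itself, so it may count as exposed or not: `S` is `⊤` for a branch
-- variable and `⊥` for one bound by a peeled λ.
RenamesOn-exts : {S : Set} {V : Pred (Fin m) 0ℓ} {σ : Fin m → Tm n m′} →
                 RenamesOn V σ → RenamesOn (S ∷ V) (exts σ)
RenamesOn-exts r zero    _ = zero , refl
RenamesOn-exts r (suc x) v with y , eq ← r x v = suc y , cong wk eq

RenamesOn-twk : {V : Pred (Fin m) 0ℓ} {σ : Fin m → Tm n m′} →
                RenamesOn V σ → RenamesOn V (λ x → twk (σ x))
RenamesOn-twk r x v with y , eq ← r x v = y , cong twk eq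

module _ {V : Pred (Fin m) 0ℓ} {σ : Fin m → Tm n m′} (r : RenamesOn V σ) where

  -- Substitution can change the head constructor only of a variable. An exposed variable goes to a
  -- variable, so no redex appears at the root; the same argument serves `⊚` and `⊚ₜ`, where an
  -- existing redex is left to the substitution lemma.
  sub-⊚ᵢ : {M : Tm n m} (i : Ix) → Exposed V M → sub σ (M ⊚ᵢ i) ≡ sub σ M ⊚ᵢ i
  sub-⊚ᵢ i (var {x} v) with σ x | r x v
  ... | _ | y , refl    = refl
  sub-⊚ᵢ i (lam e)      = refl
  sub-⊚ᵢ i app          = refl
  sub-⊚ᵢ 𝟏 (pair e f)   = refl
  sub-⊚ᵢ 𝟐 (pair e f)   = refl
  sub-⊚ᵢ i proj         = refl
  sub-⊚ᵢ i (Lam e)      = refl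
  sub-⊚ᵢ i tapp         = refl

  sub-⊚ : {M : Tm n m} (N : Tm n m) → Exposed V M → sub σ (M ⊚ N) ≡ sub σ M ⊚ sub σ N
  sub-⊚ N (var {x} v) with σ x | r x v
  ... | _ | y , refl        = refl
  sub-⊚ N (lam {M = P} e)   = sub-[] σ P N
  sub-⊚ N app               = refl
  sub-⊚ N (pair e f)        = refl
  sub-⊚ N proj              = refl
  sub-⊚ N (Lam e)           = refl
  sub-⊚ N tapp              = refl

  sub-⊚ₜ : {M : Tm n m} (Y : Fin n) → Exposed V M → sub σ (M ⊚ₜ Y) ≡ sub σ M ⊚ₜ Y
  sub-⊚ₜ Y (var {x} v) with σ x | r x v
  ... | _ | y , refl        = refl
  sub-⊚ₜ Y (lam e)          = refl
  sub-⊚ₜ Y app              = refl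
  sub-⊚ₜ Y (pair e f)       = refl
  sub-⊚ₜ Y proj             = refl
  sub-⊚ₜ Y (Lam {M = P} e)  = sub-[]ₜ σ P Y
  sub-⊚ₜ Y tapp             = refl

CASE-cong : {M M′ : Tm n m} {P P′ Q Q′ : Tm n (suc m)} {A B : Ty n} (C : Ty n) →
            M ≡ M′ → P ≡ P′ → Q ≡ Q′ → CASE M A P B Q C ≡ CASE M′ A P′ B Q′ C
CASE-cong C refl refl refl = refl

ext-suc-∈ : {V : Pred (Fin m) 0ℓ} → ∀ x → (⊤ ∷ V) x → (⊤ ∷ ⊥ ∷ V) (ext suc x)
ext-suc-∈ zero    _ = tt
ext-suc-∈ (suc x) v = v

-- This is a branch of `CASE` at an implication, where index 1 is the fresh z. Since z enters only
-- as an argument, it can be placed in `⊥`, and hence later be replaced by any term.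
Exposed-ren-⊚ : {V : Pred (Fin m) 0ℓ} {P : Tm n (suc m)} {N : Tm n (suc (suc m))} →
                Exposed (⊤ ∷ V) P → Exposed (⊤ ∷ ⊥ ∷ V) (ren (ext suc) P ⊚ N)
Exposed-ren-⊚ {V = V} e = Exposed-⊚ (Exposed-ren (ext-suc-∈ {V = V}) e)

sub-ren-ext-suc : (σ : Fin m → Tm n m′) (P : Tm n (suc m)) →
                  sub (exts (exts σ)) (ren (ext suc) P) ≡ ren (ext suc) (sub (exts σ) P)
sub-ren-ext-suc σ P = trans (sub-ren (λ _ → refl) P) (sym (ren-sub
  (λ { zero → refl ; (suc x) → ren-wk suc (σ x) }) P))

-- Induction on `C`, with `V` and `σ` varying as binders are crossed. The branch variable is in `⊤`
-- because a branch may be that very variable, which `exts σ` fixes.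
sub-CASE : {V : Pred (Fin m) 0ℓ} {σ : Fin m → Tm n m′} → RenamesOn V σ →
           {M : Tm n m} {A B : Ty n} {P Q : Tm n (suc m)} (C : Ty n) →
           Exposed V M → Exposed (⊤ ∷ V) P → Exposed (⊤ ∷ V) Q →
           sub σ (CASE M A P B Q C) ≡ CASE (sub σ M) A (sub (exts σ) P) B (sub (exts σ) Q) C
sub-CASE r (tvar X) e _ _ =
  trans (sub-⊚ r _ (Exposed-⊚ₜ e)) (cong (_⊚ _) (sub-⊚ₜ r X e))
sub-CASE {V = V} {σ} r {M} {A} {B} {P} {Q} (C₁ ∧ C₂) e f g = cong₂ pair (at 𝟏 C₁) (at 𝟐 C₂)
  where
  at : ∀ i C → sub σ (CASE M A (P ⊚ᵢ i) B (Q ⊚ᵢ i) C) ≡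
               CASE (sub σ M) A (sub (exts σ) P ⊚ᵢ i) B (sub (exts σ) Q ⊚ᵢ i) C
  at i C = trans (sub-CASE r C e (Exposed-⊚ᵢ i f) (Exposed-⊚ᵢ i g))
                 (CASE-cong C refl (sub-⊚ᵢ (RenamesOn-exts r) i f)
                                   (sub-⊚ᵢ (RenamesOn-exts r) i g))
sub-CASE {V = V} {σ} r {M} (C₁ ⊃ C₂) e f g =
  cong (lam C₁) (trans
    (sub-CASE r′ C₂ (Exposed-wk e) (Exposed-ren-⊚ {V = V} f) (Exposed-ren-⊚ {V = V} g))
    (CASE-cong C₂ (sub-wk σ M) (branch f) (branch g)))
  where
  r′ : RenamesOn (⊥ ∷ V) (exts σ)
  r′ = RenamesOn-exts r
  branch : ∀ {P} → Exposed (⊤ ∷ V) P →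
           sub (exts (exts σ)) (ren (ext suc) P ⊚ var (suc zero)) ≡
           ren (ext suc) (sub (exts σ) P) ⊚ var (suc zero)
  branch {P} f = trans
    (sub-⊚ (RenamesOn-exts r′) _ (Exposed-ren (ext-suc-∈ {V = V}) f))
    (cong (_⊚ _) (sub-ren-ext-suc σ P))
sub-CASE {V = V} {σ} r {M} (all C) e f g =
  cong Lam (trans
    (sub-CASE r′ C (Exposed-tren e) (Exposed-⊚ₜ (Exposed-tren f)) (Exposed-⊚ₜ (Exposed-tren g)))
    (CASE-cong C (sub-twk σ M) (branch f) (branch g)))
  where
  r′ : RenamesOn V (λ x → twk (σ x))
  r′ = RenamesOn-twk r
  branch : ∀ {P} → Exposed (⊤ ∷ V) P →
           sub (exts (λ x → twk (σ x))) (twk P ⊚ₜ zero) ≡ twk (sub (exts σ) P) ⊚ₜ zero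
  branch {P} f = trans
    (sub-⊚ₜ (RenamesOn-exts r′) zero (Exposed-tren f))
    (cong (_⊚ₜ zero) (sym (tren-sub (tren-exts (λ _ → refl)) P)))

sub-ABORT : {V : Pred (Fin m) 0ℓ} {σ : Fin m → Tm n m′} → RenamesOn V σ →
            {M : Tm n m} (A : Ty n) → Exposed V M → sub σ (ABORT M A) ≡ ABORT (sub σ M) A
sub-ABORT r (tvar X)  e = sub-⊚ₜ r X e
sub-ABORT r (A₁ ∧ A₂) e = cong₂ pair (sub-ABORT r A₁ e) (sub-ABORT r A₂ e)
sub-ABORT {V = V} {σ} r {M} (A₁ ⊃ A₂) e = cong (lam A₁) (trans
  (sub-ABORT {V = ⊥ ∷ V} (RenamesOn-exts r) A₂ (Exposed-wk e))
  (cong (λ T → ABORT T A₂) (sub-wk σ M)))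
sub-ABORT {σ = σ} r {M} (all A) e = cong Lam (trans
  (sub-ABORT (RenamesOn-twk r) A (Exposed-tren e))
  (cong (λ T → ABORT T A) (sub-twk σ M)))

-- The translation commutes with weakening

-- Stated with sub rather than ren, so that the substitution lemmas for @, CASE
-- and ABORT apply; σ is kept abstract because exts (var ∘ ρ) and var ∘ ext ρ
-- agree only pointwise.
◇-ren-sub : {ρ : Fin m → Fin m′} {σ : Fin m → Tm n m′} → (∀ x → σ x ≡ var (ρ x)) →
            (M : IPC.Tm n m) → IPC.ren ρ M ◇ ≡ sub σ (M ◇)
◇-ren-sub {m = m} {n = n} {ρ = ρ} {σ} h = go
  where
  r : RenamesOn (λ _ → ⊤) σ
  r x _ = ρ x , h x

  e : (M : IPC.Tm n m) → Exposed (λ _ → ⊤) (M ◇)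
  e = ◇-Exposed (λ _ → tt)

  -- The predicate `⊤ ∷ λ _ → ⊤` holds everywhere, but reduces to `⊤` only after the index is split.
  e′ : (P : IPC.Tm n (suc m)) → Exposed (⊤ ∷ λ _ → ⊤) (P ◇)
  e′ = ◇-Exposed (λ { zero → tt ; (suc _) → tt })

  h′ : ∀ x → exts σ x ≡ var (ext ρ x)
  h′ zero    = refl
  h′ (suc x) = cong wk (h x)

  go : (M : IPC.Tm n m) → IPC.ren ρ M ◇ ≡ sub σ (M ◇)
  go (IPC.var x)    = sym (h x)
  go (IPC.lam A M)  = trans
    (cong (lam̲ (A ◇ₜ)) (◇-ren-sub h′ M))
    (cong (λ T → lam (A ◇ₜ) (app T (var zero))) (sym (sub-wk σ (lam (A ◇ₜ) (M ◇)))))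
  go (IPC.app M N)  = trans (cong₂ _⊚_ (go M) (go N)) (sym (sub-⊚ r (N ◇) (e M)))
  go (IPC.pair M N) = cong₂ ⟪_,_⟫ (go M) (go N)
  go (IPC.proj M i) = trans (cong (_⊚ᵢ i) (go M)) (sym (sub-⊚ᵢ r i (e M)))
  go (IPC.inj i M A B) = trans
    (cong (λ T → IN i T (A ◇ₜ) (B ◇ₜ)) (go M))
    (cong (λ T → Lam (lam _ (app (proj (var zero) i) T)))
          (trans (cong wk (sym (sub-twk σ (M ◇))))
                 (sym (sub-wk (λ x → twk (σ x)) (twk (M ◇))))))
  go (IPC.case M A P B Q C) = trans
    (CASE-cong (C ◇ₜ) (go M) (◇-ren-sub h′ P) (◇-ren-sub h′ Q))
    (sym (sub-CASE r (C ◇ₜ) (e M) (e′ P) (e′ Q)))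
  go (IPC.abort M A) = trans
    (cong (λ T → ABORT T (A ◇ₜ)) (go M)) (sym (sub-ABORT r (A ◇ₜ) (e M)))

◇-wk : (N : IPC.Tm n m) → IPC.wk N ◇ ≡ wk (N ◇)
◇-wk N = trans (◇-ren-sub (λ _ → refl) N) (sub-var-ren suc (N ◇))

-- The commuting conversion for implication

-- The left side computes to `inst N` applied to the body of the λ, so `sub-CASE` applies once z,
-- the variable replaced by `N`, is put in `⊥`.
CASE-⊃-⊚ : {M : Tm n m} {A B : Ty n} {P Q : Tm n (suc m)} (C D : Ty n) (N : Tm n m) →
           Exposed (λ _ → ⊤) M → Exposed (⊤ ∷ λ _ → ⊤) P → Exposed (⊤ ∷ λ _ → ⊤) Q →
           CASE M A P B Q (C ⊃ D) ⊚ N ≡ CASE M A (P ⊚ wk N) B (Q ⊚ wk N) D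
CASE-⊃-⊚ {n = n} {m = m} {M = M} C D N e f g = trans
  (sub-CASE r D (Exposed-wk e) (Exposed-ren-⊚ {V = λ _ → ⊤} f) (Exposed-ren-⊚ {V = λ _ → ⊤} g))
  (CASE-cong D (sub-ren-id (λ _ → refl) M) (branch f) (branch g))
  where
  r : RenamesOn (⊥ ∷ λ _ → ⊤) (inst N)
  r zero    ()
  r (suc x) _ = x , refl

  branch : {P : Tm n (suc m)} → Exposed (⊤ ∷ λ _ → ⊤) P →
           sub (exts (inst N)) (ren (ext suc) P ⊚ var (suc zero)) ≡ P ⊚ wk N
  -- `exts (inst N)` sends index 1, which is z, to `wk N`, and it cancels the renaming `ext suc` of
  -- `P`.
  branch {P} f = trans
    (sub-⊚ (RenamesOn-exts r) _ (Exposed-ren (ext-suc-∈ {V = λ _ → ⊤}) f))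
    (cong (_⊚ wk N) (sub-ren-id (λ { zero → refl ; (suc x) → refl }) P))

CASE-◇-⊚ : (M : IPC.Tm n m) (A₁ A₂ : IPC.Ty n) (P₁ P₂ : IPC.Tm n (suc m))
           (N : IPC.Tm n m) (C D : IPC.Ty n) →
           CASE (M ◇) (A₁ ◇ₜ) (P₁ ◇) (A₂ ◇ₜ) (P₂ ◇) ((C ◇ₜ) ⊃ (D ◇ₜ)) ⊚ (N ◇) ≡
           CASE (M ◇) (A₁ ◇ₜ) ((P₁ ◇) ⊚ wk (N ◇)) (A₂ ◇ₜ) ((P₂ ◇) ⊚ wk (N ◇)) (D ◇ₜ)
CASE-◇-⊚ M A₁ A₂ P₁ P₂ N C D = CASE-⊃-⊚ (C ◇ₜ) (D ◇ₜ) (N ◇)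
  (◇-Exposed (λ _ → tt) M) (◇-Exposed all⊤ P₁) (◇-Exposed all⊤ P₂)
  where
  all⊤ : ∀ x → (⊤ ∷ λ _ → ⊤) x
  all⊤ zero    = tt
  all⊤ (suc _) = tt

-- Unfolding `◇` on the right already gives `CASE` with `⊚` in its branches; the one gap is that `N`
-- is weakened before translation there and after it on the left.
CASE-◇-wk : (M : IPC.Tm n m) (A₁ A₂ : IPC.Ty n) (P₁ P₂ : IPC.Tm n (suc m))
            (N : IPC.Tm n m) (D : IPC.Ty n) →
            CASE (M ◇) (A₁ ◇ₜ) ((P₁ ◇) ⊚ wk (N ◇)) (A₂ ◇ₜ) ((P₂ ◇) ⊚ wk (N ◇)) (D ◇ₜ) ≡
            IPC.case M A₁ (IPC.app P₁ (IPC.wk N)) A₂ (IPC.app P₂ (IPC.wk N)) D ◇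
CASE-◇-wk M A₁ A₂ P₁ P₂ N D = cong
  (λ T → CASE (M ◇) (A₁ ◇ₜ) ((P₁ ◇) ⊚ T) (A₂ ◇ₜ) ((P₂ ◇) ⊚ T) (D ◇ₜ)) (sym (◇-wk N))

theorem2 :
    (∀ {n m : ℕ} (M : IPC.Tm n m) (A₁ A₂ : IPC.Ty n) (P₁ P₂ : IPC.Tm n (suc m)) (N : IPC.Tm n m) (C D : IPC.Ty n) →
      let M₁ = IPC.app (IPC.case M A₁ P₁ A₂ P₂ (C IPC.⊃ D)) N
          M₂ = IPC.case M A₁ (IPC.app P₁ (IPC.wk N)) A₂ (IPC.app P₂ (IPC.wk N)) D
          K₁ = Fat.CASE (M ◇) (A₁ ◇ₜ) (P₁ ◇) (A₂ ◇ₜ) (P₂ ◇) ((C ◇ₜ) Fat.⊃ (D ◇ₜ)) Fat.⊚ (N ◇)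
          K₂ = Fat.CASE (M ◇) (A₁ ◇ₜ) ((P₁ ◇) Fat.⊚ Fat.wk (N ◇)) (A₂ ◇ₜ) ((P₂ ◇) Fat.⊚ Fat.wk (N ◇)) (D ◇ₜ)
      in (M₁ ◇ ≡ K₁) × (K₁ ≡ K₂) × (K₂ ≡ M₂ ◇))
    × (∀ {n m : ℕ} {R S : IPC.Tm n m} → R IPC.⟶π⊃ S → R ◇ ≡ S ◇)
theorem2 =
    (λ M A₁ A₂ P₁ P₂ N C D →
       -- The first identity is the defining clauses of `◇` for application, case and implication.
       refl , CASE-◇-⊚ M A₁ A₂ P₁ P₂ N C D , CASE-◇-wk M A₁ A₂ P₁ P₂ N D)
  , λ { (IPC.π⊃ M A₁ P₁ A₂ P₂ C D N) →
        trans (CASE-◇-⊚ M A₁ A₂ P₁ P₂ N C D) (CASE-◇-wk M A₁ A₂ P₁ P₂ N D) }
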